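{- A horizontal generating function of the $(q,r)$-Whitney-Lah numbers $L_{m,r}[n,k]_q$ is given by $$\sum_{k=0}^n L_{m,r}[n,k]_q\,[t|m]_{k,q}=[t+2r|m]_{\overline{n},q},$$ where $[t+2r|m]_{\overline{n},q}=\prod_{i=0}^{n-1}[t+2r+im]_q$ if $n\ge 1$, and $[t+2r|m]_{\overline{n},q}=1$ if $n=0$.
   Context: Here $q,m,r$ are parameters, and $[x]_q=\frac{q^x-1}{q-1}$, so that $[t-k]_q=\frac{1}{q^k}([t]_q-[k]_q)$. Also $[t|m]_{0,q}=1$ and $[t|m]_{k+1,q}=[t|m]_{k,q}[t-km]_q$, i.e. $[t|m]_{k,q}=\prod_{i=0}^{k-1}[t-im]_q$. The $(q,r)$-Whitney-Lah numbers are defined by $$L_{m,r}[n,k]_q=q^{2r+m(k-1)+m(n-1)}L_{m,r}[n-1,k-1]_q+[2r+km+(n-1)m]_q\,L_{m,r}[n-1,k]_q,$$ with $L_{m,r}[n,k]_q=0$ if $n<k$ or $n,k<0$, and $L_{m,r}[n,k]_q=1$ if $n=k$ and $n\ge 0$.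
   Formalization: The rule L[n,k]=1 for n=k contradicts the recurrence (which gives L[1,1]=q^{2r}) and would make the identity false at n=1; here only L[0,0]=1 is imposed, and the recurrence is used for all n≥1. -}

module Defs where

open import Algebra.Apartness.Bundles using (HeytingField; HeytingCommutativeRing)
open import Algebra.Bundles using (CommutativeRing)
open import Algebra.Morphism.Structures using (module MonoidMorphisms)
import Algebra.Definitions.RawMonoid as RawMonoidDefs
open import Data.Fin.Base using (Fin; toℕ)
open import Data.Nat.Base as ℕ using (ℕ; zero; suc; z<s; s<s)
open import Data.Product.Base using (proj₁)
open import Level using (Level; _⊔_)
import Relation.Binary.Reasoning.Setoid as SetoidReasoning

private
  variable
    a b c ℓ ℓ₁ ℓ₂ : Level

fieldRing : HeytingField c ℓ₁ ℓ₂ → CommutativeRing c ℓ₁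
fieldRing K =
  HeytingCommutativeRing.commutativeRing (HeytingField.heytingCommutativeRing K)

-- A choice of powers q^x for all x in a ring E of admissible exponents:
-- E = ℤ and q ≠ 0; E = K = ℝ and q > 0; E = K = ℂ with a chosen branch of
-- log q; or, for formal parameters t, m and r, E = ℤ[t,m,r] with K the
-- field generated by q, q^t, q^m, ….
record Powers (E : CommutativeRing a ℓ) (K : HeytingField c ℓ₁ ℓ₂)
              (q : HeytingField.Carrier K) : Set (a ⊔ ℓ ⊔ c ⊔ ℓ₁ ⊔ ℓ₂) where
  private
    module E = CommutativeRing E
    module K = CommutativeRing (fieldRing K)
  open MonoidMorphisms E.+-rawMonoid K.*-rawMonoid using (IsMonoidHomomorphism)
  field
    q^_                     : E.Carrier → K.Carrier
    q^-isMonoidHomomorphism : IsMonoidHomomorphism q^_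
    q^1≈q                   : q^ E.1# K.≈ q

module QCalculus
  (E : CommutativeRing a ℓ) (K : HeytingField c ℓ₁ ℓ₂)
  {q : HeytingField.Carrier K}
  (q#1 : HeytingField._#_ K q (HeytingField.1# K))
  (pow : Powers E K q)
  where

  private
    module E = CommutativeRing E
    module F = HeytingField K
    module K = CommutativeRing (fieldRing K)
  open Powers pow using (q^_)

  infixl 6 _⊕_ _⊖_
  infixl 7 _·_

  -- Operations on exponents; k · x is the k-fold sum of x.

  _⊕_ _⊖_ : E.Carrier → E.Carrier → E.Carrier
  _⊕_ = E._+_
  _⊖_ = E._-_

  _·_ : ℕ → E.Carrier → E.Carrier
  _·_ = RawMonoidDefs._×_ E.+-rawMonoid

  ∑ ∏ : (n : ℕ) → (Fin n → K.Carrier) → K.Carrier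
  ∑ n f = RawMonoidDefs.sum K.+-rawMonoid f
  ∏ n f = RawMonoidDefs.sum K.*-rawMonoid f

  -- [ x ] = (q^x − 1) / (q − 1)
  [_] : E.Carrier → K.Carrier
  [ x ] = (q^ x K.- K.1#) K.* proj₁ (F.#⇒invertible q#1)

  -- [t|m]_{k,q}
  falling : (t m : E.Carrier) → ℕ → K.Carrier
  falling t m zero    = K.1#
  falling t m (suc k) = falling t m k K.* [ t ⊖ k · m ]

  -- [t|m]_{k̄,q}
  rising : (t m : E.Carrier) → ℕ → K.Carrier
  rising t m n = ∏ n λ i → [ t ⊕ toℕ i · m ]

  -- The (q,r)-Whitney–Lah numbers L_{m,r}[n,k]_q. The recurrence governs every
  -- n ≥ 1, so 1 is imposed on the diagonal only at n = k = 0: imposing it on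
  -- the whole diagonal would contradict the recurrence, which gives
  -- L_{m,r}[1,1]_q = q^{2r}. At k = 0 the term with k − 1 < 0 is absent.
  L : (m r : E.Carrier) → ℕ → ℕ → K.Carrier
  L m r zero    zero    = K.1#
  L m r zero    (suc k) = K.0#
  L m r (suc n) zero    = [ 2 · r ⊕ 0 · m ⊕ n · m ] K.* L m r n zero
  L m r (suc n) (suc k) =
    q^ (2 · r ⊕ k · m ⊕ n · m) K.* L m r n k
      K.+ [ 2 · r ⊕ suc k · m ⊕ n · m ] K.* L m r n (suc k)

  -- The remaining boundary values follow from the recurrence.
  n<k⇒L≈0 : ∀ m r {n k} → n ℕ.< k → L m r n k K.≈ K.0#
  n<k⇒L≈0 m r {zero}  {suc k} z<s       = K.refl
  n<k⇒L≈0 m r {suc n} {suc k} (s<s n<k) = begin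
    u K.* L m r n k K.+ v K.* L m r n (suc k)
      ≈⟨ K.+-cong (K.*-congˡ (n<k⇒L≈0 m r n<k))
                  (K.*-congˡ (n<k⇒L≈0 m r (m<n⇒m<1+n n<k))) ⟩
    u K.* K.0# K.+ v K.* K.0#  ≈⟨ K.+-cong (K.zeroʳ u) (K.zeroʳ v) ⟩
    K.0# K.+ K.0#              ≈⟨ K.+-identityˡ K.0# ⟩
    K.0#                       ∎
    where
    open SetoidReasoning K.setoid
    open import Data.Nat.Properties using (m<n⇒m<1+n)
    u = q^ (2 · r ⊕ k · m ⊕ n · m)
    v = [ 2 · r ⊕ suc k · m ⊕ n · m ]

{-# OPTIONS --safe #-}
-- With x = 2r + km + nm, the identity [x + y] = q^x [y] + [x] at y = t − km
-- reads q^x [t − km] + [x] = [t + 2r + nm], which does not depend on k. Hence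
-- the recurrence for L multiplies the sum by [t + 2r + nm] when n grows by one.
module Submission where

open import Defs
open import Algebra.Apartness.Bundles using (HeytingField)
open import Algebra.Bundles using (CommutativeRing; Monoid)
open import Algebra.Morphism.Structures using (module MonoidMorphisms)
import Algebra.Properties.AbelianGroup as AbelianGroupProperties
import Algebra.Properties.CommutativeSemigroup as CommutativeSemigroupProperties
import Algebra.Properties.Monoid.Sum as MonoidSum
import Algebra.Properties.Semiring.Sum as SemiringSum
open import Data.Fin.Base using (toℕ)
open import Data.Fin.Properties using (toℕ-fromℕ; toℕ-inject₁)
open import Data.Nat.Base using (ℕ; zero; suc)
open import Data.Nat.Properties using (n<1+n)
open import Data.Product.Base using (proj₁)
open import Function.Base using (_∘_)
open import Level using (Level)
open import Relation.Binary.PropositionalEquality.Core using (cong)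
import Relation.Binary.Reasoning.Setoid as SetoidReasoning

module _ {a ℓ} (M : Monoid a ℓ) where
  open Monoid M
  open MonoidSum M

  -- `sum` unfolds at its first term, but the induction on `n` adds terms at the end. Being stated
  -- for a monoid, this serves both the product `rising` and the sum of the `B` terms.
  sum-toℕ-last : ∀ (f : ℕ → Carrier) n →
                 sum {suc n} (f ∘ toℕ) ≈ sum {n} (f ∘ toℕ) ∙ f n
  sum-toℕ-last f n = trans (sum-init-last {n} (f ∘ toℕ))
    (∙-cong (sum-cong-≋ {n} λ i → reflexive (cong f (toℕ-inject₁ i)))
            (reflexive (cong f (toℕ-fromℕ n))))

module _
  {a ℓ c ℓ₁ ℓ₂ : Level}
  (E : CommutativeRing a ℓ) (K : HeytingField c ℓ₁ ℓ₂)
  {q : HeytingField.Carrier K}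
  (q#1 : HeytingField._#_ K q (HeytingField.1# K))
  (pow : Powers E K q)
  where

  private
    module E where
      open CommutativeRing E public
      open AbelianGroupProperties +-abelianGroup public using (xyx⁻¹≈y)
      open CommutativeSemigroupProperties +-commutativeSemigroup public
        using (xy∙z≈xz∙y)
  open CommutativeRing (fieldRing K)
  open CommutativeSemigroupProperties *-commutativeSemigroup
    using (interchange)
  open SemiringSum semiring using (sum-cong-≋; ∑-distrib-+; *-distribˡ-sum)
  open QCalculus E K q#1 pow
  open Powers pow
  open MonoidMorphisms.IsMonoidHomomorphism q^-isMonoidHomomorphism
    using (⟦⟧-cong; homo)

  []-cong : ∀ {x y} → x E.≈ y → [ x ] ≈ [ y ]
  []-cong x≈y = *-congʳ (+-congʳ (⟦⟧-cong x≈y))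

  -- Since `q^_` turns sums into products, the numerator telescopes: `q^ x * q^ y - 1#` passes
  -- through `q^ x`. Multiplying by the inverse `w` of `q - 1#` gives the claim.
  []-⊕ : ∀ x y → [ x ⊕ y ] ≈ q^ x * [ y ] + [ x ]
  []-⊕ x y = begin
    (q^ (x ⊕ y) - 1#) * w                     ≈⟨ *-congʳ (+-congʳ (homo x y)) ⟩
    (q^ x * q^ y - 1#) * w                    ≈⟨ *-congʳ lemma ⟨
    (q^ x * (q^ y - 1#) + (q^ x - 1#)) * w    ≈⟨ distribʳ w _ _ ⟩
    q^ x * (q^ y - 1#) * w + (q^ x - 1#) * w  ≈⟨ +-congʳ (*-assoc _ _ w) ⟩
    q^ x * [ y ] + [ x ]                      ∎
    where
    open SetoidReasoning setoid
    w = proj₁ (HeytingField.#⇒invertible K q#1)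
    lemma : q^ x * (q^ y - 1#) + (q^ x - 1#) ≈ q^ x * q^ y - 1#
    lemma = begin
      q^ x * (q^ y - 1#) + (q^ x - 1#)
        ≈⟨ +-assoc _ _ _ ⟨
      q^ x * (q^ y - 1#) + q^ x - 1#
        ≈⟨ +-congʳ (+-congˡ (*-identityʳ (q^ x))) ⟨
      q^ x * (q^ y - 1#) + q^ x * 1# - 1#
        ≈⟨ +-congʳ (distribˡ (q^ x) _ _) ⟨
      q^ x * (q^ y - 1# + 1#) - 1#
        ≈⟨ +-congʳ (*-congˡ (trans (+-assoc _ _ _) (+-congˡ (-‿inverseˡ 1#)))) ⟩
      q^ x * (q^ y + 0#) - 1#
        ≈⟨ +-congʳ (*-congˡ (+-identityʳ (q^ y))) ⟩
      q^ x * q^ y - 1#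
        ∎

  -- Used with `u = k · m`: this is where the dependence on `k` disappears. Moving `u` to the front
  -- turns the sum into a conjugate by `u`, which is trivial in an abelian group.
  ⊕-⊖-cancel : ∀ r′ u v t → r′ ⊕ u ⊕ v ⊕ (t ⊖ u) E.≈ t ⊕ r′ ⊕ v
  ⊕-⊖-cancel r′ u v t = begin
    r′ ⊕ u ⊕ v ⊕ (t ⊖ u)     ≈⟨ E.+-congʳ (E.+-congʳ (E.+-comm r′ u)) ⟩
    u ⊕ r′ ⊕ v ⊕ (t ⊖ u)     ≈⟨ E.+-assoc _ t _ ⟨
    u ⊕ r′ ⊕ v ⊕ t E.- u     ≈⟨ E.+-congʳ (E.+-congʳ (E.+-assoc u r′ v)) ⟩
    u ⊕ (r′ ⊕ v) ⊕ t E.- u   ≈⟨ E.+-congʳ (E.+-assoc u _ t) ⟩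
    u ⊕ (r′ ⊕ v ⊕ t) E.- u   ≈⟨ E.xyx⁻¹≈y u _ ⟩
    r′ ⊕ v ⊕ t               ≈⟨ E.xy∙z≈xz∙y r′ v t ⟩
    r′ ⊕ t ⊕ v               ≈⟨ E.+-congʳ (E.+-comm r′ t) ⟩
    t ⊕ r′ ⊕ v               ∎
    where open SetoidReasoning E.setoid

  rising-suc : ∀ t m n → rising t m (suc n) ≈ rising t m n * [ t ⊕ n · m ]
  rising-suc t m = sum-toℕ-last *-monoid (λ i → [ t ⊕ i · m ])

  module _ (m r t : E.Carrier) where

    horizontalSum : ℕ → Carrier
    horizontalSum n = ∑ (suc n) λ k → L m r n (toℕ k) * falling t m (toℕ k)

    -- The recurrence splits term `suc k` of the new sum into `A k + B (suc k)`. Shifting the `B`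
    -- part back by one index pairs `A k` with `B k`, and each pair is `s` times term `k` of the old
    -- sum.
    horizontalSum-suc : ∀ n →
      horizontalSum (suc n) ≈ horizontalSum n * [ t ⊕ 2 · r ⊕ n · m ]
    horizontalSum-suc n = begin
      -- The term at index 0 is `B 0` by definition, as the recurrence has a single summand there.
      B 0 + ∑ (suc n) (λ k → L m r (suc n) (suc (toℕ k)) * F (suc (toℕ k)))
        ≈⟨ +-congˡ (sum-cong-≋ {suc n} λ k → distribʳ (F (suc (toℕ k)))
             (q^ x (toℕ k) * L m r n (toℕ k))
             ([ x (suc (toℕ k)) ] * L m r n (suc (toℕ k)))) ⟩
      B 0 + ∑ (suc n) (λ k → A (toℕ k) + B (suc (toℕ k)))
        ≈⟨ +-congˡ (∑-distrib-+ {suc n} (A ∘ toℕ) (B ∘ suc ∘ toℕ)) ⟩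
      B 0 + (∑A + ∑ (suc n) (B ∘ suc ∘ toℕ))
        ≈⟨ x+yz≈y+xz (B 0) ∑A _ ⟩
      -- `B 0` and the shifted sum are by definition one sum over indices 0 to `suc n`. Its last
      -- term vanishes, which leaves the index range of `∑A`.
      ∑A + ∑ (suc (suc n)) (B ∘ toℕ)
        ≈⟨ +-congˡ (sum-toℕ-last +-monoid B (suc n)) ⟩
      ∑A + (∑ (suc n) (B ∘ toℕ) + B (suc n))
        ≈⟨ +-congˡ (trans (+-congˡ B[1+n]≈0) (+-identityʳ _)) ⟩
      ∑A + ∑ (suc n) (B ∘ toℕ)
        ≈⟨ ∑-distrib-+ {suc n} (A ∘ toℕ) (B ∘ toℕ) ⟨
      ∑ (suc n) (λ k → A (toℕ k) + B (toℕ k))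
        ≈⟨ sum-cong-≋ {suc n} (λ k → A+B (toℕ k)) ⟩
      ∑ (suc n) (λ k → s * (L m r n (toℕ k) * F (toℕ k)))
        ≈⟨ *-distribˡ-sum {suc n} s (λ k → L m r n (toℕ k) * F (toℕ k)) ⟨
      s * horizontalSum n
        ≈⟨ *-comm s _ ⟩
      horizontalSum n * s
        ∎
      where
      open SetoidReasoning setoid
      open CommutativeSemigroupProperties +-commutativeSemigroup
        using () renaming (x∙yz≈y∙xz to x+yz≈y+xz)
      -- `A k` and `B k` are what `L m r n k` contributes to the new sum: `A k` to its term `suc k`,
      -- `B k` to its term `k`.
      F A B : ℕ → Carrier
      x : ℕ → E.Carrier
      F = falling t m
      x k = 2 · r ⊕ k · m ⊕ n · m
      A k = q^ (x k) * L m r n k * F (suc k)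
      B k = [ x k ] * L m r n k * F k
      ∑A s : Carrier
      ∑A = ∑ (suc n) (A ∘ toℕ)
      s = [ t ⊕ 2 · r ⊕ n · m ]

      B[1+n]≈0 : B (suc n) ≈ 0#
      B[1+n]≈0 = begin
        [ x (suc n) ] * L m r n (suc n) * F (suc n)
          ≈⟨ *-congʳ (*-congˡ (n<k⇒L≈0 m r (n<1+n n))) ⟩
        [ x (suc n) ] * 0# * F (suc n)  ≈⟨ *-congʳ (zeroʳ _) ⟩
        0# * F (suc n)                  ≈⟨ zeroˡ _ ⟩
        0#                              ∎

      A+B : ∀ k → A k + B k ≈ s * (L m r n k * F k)
      A+B k = begin
        -- `F (suc k)` unfolds to `F k * y`, so both summands contain `l * F k`; the remaining
        -- factor has the shape of `[]-⊕`.
        q^ (x k) * l * (F k * y) + [ x k ] * l * F k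
          ≈⟨ +-congʳ (*-congˡ (*-comm (F k) y)) ⟩
        q^ (x k) * l * (y * F k) + [ x k ] * l * F k
          ≈⟨ +-cong (interchange _ l y _) (*-assoc _ l _) ⟩
        q^ (x k) * y * (l * F k) + [ x k ] * (l * F k)
          ≈⟨ distribʳ (l * F k) _ _ ⟨
        (q^ (x k) * y + [ x k ]) * (l * F k)
          ≈⟨ *-congʳ ([]-⊕ (x k) (t ⊖ k · m)) ⟨
        [ x k ⊕ (t ⊖ k · m) ] * (l * F k)
          ≈⟨ *-congʳ ([]-cong (⊕-⊖-cancel (2 · r) (k · m) (n · m) t)) ⟩
        s * (l * F k)
          ∎
        where
        l = L m r n k
        y = [ t ⊖ k · m ]

    horizontalSum≈rising : ∀ n → horizontalSum n ≈ rising (t ⊕ 2 · r) m n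
    -- The only term is `1# * 1#`, followed by the empty sum `0#`; the product on the right is
    -- empty.
    horizontalSum≈rising zero    = trans (+-identityʳ _) (*-identityˡ 1#)
    horizontalSum≈rising (suc n) = begin
      horizontalSum (suc n)             ≈⟨ horizontalSum-suc n ⟩
      horizontalSum n * s               ≈⟨ *-congʳ (horizontalSum≈rising n) ⟩
      rising (t ⊕ 2 · r) m n * s        ≈⟨ rising-suc (t ⊕ 2 · r) m n ⟨
      rising (t ⊕ 2 · r) m (suc n)      ∎
      where
      open SetoidReasoning setoid
      s = [ t ⊕ 2 · r ⊕ n · m ]

theorem3p1 :
  ∀ {a ℓ c ℓ₁ ℓ₂ : Level}
    (E : CommutativeRing a ℓ) (K : HeytingField c ℓ₁ ℓ₂)
    (q : HeytingField.Carrier K)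
    (q#1 : HeytingField._#_ K q (HeytingField.1# K))
    (pow : Powers E K q) →
  let open HeytingField K
      open QCalculus E K q#1 pow in
  (m r t : CommutativeRing.Carrier E) (n : ℕ) →
  ∑ (suc n) (λ k → L m r n (toℕ k) * falling t m (toℕ k))
    ≈ rising (t ⊕ 2 · r) m n
theorem3p1 E K q q#1 pow = horizontalSum≈rising E K q#1 pow
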